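{- Every semi-Nelson algebra $\mathbf{A}$ is isomorphic (as a semi-Nelson algebra) to an algebra of the form $\mathbf{N(H,F)}$ for some semi-Heyting algebra $\mathbf{H}$ and some $i$-filter $F$ of $\mathbf{H}$.
   Context: **Semi-Heyting algebra**: an algebra $\mathbf{H}=\langle H;\land,\lor,\Rightarrow,0,1\rangle$ of type $(2,2,2,0,0)$ such that $\langle H,\land,\lor,0,1\rangle$ is a bounded lattice and for all $x,y,z\in H$: $x\land(x\Rightarrow y)=x\land y$; $x\land(y\Rightarrow z)=x\land((x\land y)\Rightarrow(x\land z))$; $x\Rightarrow x=1$. Write $x^*=x\Rightarrow 0$ (this is the pseudocomplement of $x$). An element $x$ is dense if $x^*=0$; $\mathcal{D}_s(H)$ is the set of dense elements of $H$. **Semi-Nelson algebra**: an algebra $\mathbf{A}=\langle A;\land,\lor,\to,\sim,1\rangle$ of type $(2,2,2,1,0)$ such that, writing $x\to_N y:=x\to(x\land y)$, for all $x,y,z\in A$: (SN1) $x\land(x\lor y)=x$; (SN2) $x\land(y\lor z)=(z\land x)\lor(y\land x)$; (SN3) $\sim\sim x=x$; (SN4) $\sim(x\land y)=\sim x\lor\sim y$; (SN5) $x\land\sim x=(x\land\sim x)\land(y\lor\sim y)$; (SN6) $x\land(x\to_N y)=x\land(\sim x\lor y)$; (SN7) $x\to_N(y\to_N z)=(x\land y)\to_N z$; (SN8) $(x\to_N y)\to_N[(y\to_N x)\to_N[(x\to z)\to_N(y\to z)]]=1$; (SN9) $(x\to_N y)\to_N[(y\to_N x)\to_N[(z\to x)\to_N(z\to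 y)]]=1$; (SN10) $(\sim(x\to y))\to_N(x\land\sim y)=1$; (SN11) $(x\land\sim y)\to_N(\sim(x\to y))=1$. **$i$-filter**: a subset $F\subseteq H$ of a semi-Heyting algebra $\mathbf{H}$ such that (IF1) $F$ is a lattice filter of $\mathbf{H}$; (IF2) $\mathcal{D}_s(H)\subseteq F$; (IF3) whenever $z,t\in H$ and $z\lor t\in F$, then for all $x\in H$, $(x\Rightarrow z)\lor(x\land t)\in F$. **The algebra $\mathbf{N(H,F)}$**: for a semi-Heyting algebra $\mathbf{H}$ and an $i$-filter $F$, $N(H,F)=\{(a,b)\in H^2: a\land b=0,\ a\lor b\in F\}$, and $\mathbf{N(H,F)}=\langle N(H,F);\sqcap,\sqcup,\to,\sim,\top\rangle$ with $(a,b)\sqcap(c,d)=(a\land c,b\lor d)$, $(a,b)\sqcup(c,d)=(a\lor c,b\land d)$, $(a,b)\to(c,d)=(a\Rightarrow c,a\land d)$, $\sim(a,b)=(b,a)$, $\top=(1,0)$. -}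

-- Algebras are taken over an arbitrary setoid equality _≈_, so that a
-- quotient of an algebra is the same carrier with a coarser _≈_.

module Defs where

open import Algebra.Core using (Op₁; Op₂)
import Algebra.Definitions
open import Algebra.Lattice.Bundles using (Lattice; RawLattice)
open import Algebra.Lattice.Structures using (IsLattice)
open import Algebra.Lattice.Morphism.Structures using (IsLatticeIsomorphism)
import Algebra.Lattice.Properties.Lattice as LatticeProperties
import Algebra.Morphism.Definitions as MorphismDefinitions
open import Data.Product.Base using (∃; _×_; _,_; proj₁; proj₂)
open import Level using (_⊔_; suc)
import Relation.Binary.Lattice as R
import Relation.Binary.Lattice.Properties.HeytingAlgebra as HeytingProperties
open import Relation.Binary.Bundles using (Poset)
open import Relation.Binary.Core using (Rel)
open import Relation.Binary.Structures using (IsEquivalence)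
import Relation.Binary.Reasoning.Setoid as SetoidReasoning
open import Relation.Unary using (Pred; _∈_)

------------------------------------------------------------------------
-- Semi-Heyting algebras

module _ {a ℓ} {A : Set a} (_≈_ : Rel A ℓ) where

  open Algebra.Definitions _≈_

  record IsSemiHeytingAlgebra (_∧_ _∨_ _⇒_ : Op₂ A) (⊥ ⊤ : A) : Set (a ⊔ ℓ) where
    field
      isLattice  : IsLattice _≈_ _∨_ _∧_
      ∨-identity : Identity ⊥ _∨_
      ∧-identity : Identity ⊤ _∧_
      ⇒-cong     : Congruent₂ _⇒_
      sh₁        : ∀ x y → (x ∧ (x ⇒ y)) ≈ (x ∧ y)
      sh₂        : ∀ x y z → (x ∧ (y ⇒ z)) ≈ (x ∧ ((x ∧ y) ⇒ (x ∧ z)))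
      sh₃        : ∀ x → (x ⇒ x) ≈ ⊤

    open IsLattice isLattice public

record SemiHeytingAlgebra c ℓ : Set (suc (c ⊔ ℓ)) where
  infixr 7 _∧_
  infixr 6 _∨_
  infixr 5 _⇒_
  infix  4 _≈_
  infix  8 _*
  field
    Carrier              : Set c
    _≈_                  : Rel Carrier ℓ
    _∧_ _∨_ _⇒_          : Op₂ Carrier
    ⊥ ⊤                  : Carrier
    isSemiHeytingAlgebra : IsSemiHeytingAlgebra _≈_ _∧_ _∨_ _⇒_ ⊥ ⊤

  open IsSemiHeytingAlgebra isSemiHeytingAlgebra public

  lattice : Lattice c ℓ
  lattice = record { isLattice = isLattice }

  _* : Op₁ Carrier
  x * = x ⇒ ⊥

  Dense : Pred Carrier ℓ
  Dense x = x * ≈ ⊥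

------------------------------------------------------------------------
-- Semi-Nelson algebras

record RawSemiNelsonAlgebra c ℓ : Set (suc (c ⊔ ℓ)) where
  infix  8 ∼_
  infixr 7 _∧_
  infixr 6 _∨_
  infixr 5 _⇾_
  infix  4 _≈_
  field
    Carrier     : Set c
    _≈_         : Rel Carrier ℓ
    _∧_ _∨_ _⇾_ : Op₂ Carrier
    ∼_          : Op₁ Carrier
    ⊤           : Carrier

  rawLattice : RawLattice c ℓ
  rawLattice = record { _≈_ = _≈_ ; _∧_ = _∧_ ; _∨_ = _∨_ }

record IsSemiNelsonAlgebra {c ℓ} (A : RawSemiNelsonAlgebra c ℓ) : Set (c ⊔ ℓ) where
  open RawSemiNelsonAlgebra A
  open Algebra.Definitions _≈_

  infixr 5 _⇾ᴺ_
  _⇾ᴺ_ : Op₂ Carrier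
  x ⇾ᴺ y = x ⇾ (x ∧ y)

  field
    isEquivalence : IsEquivalence _≈_
    ∧-cong        : Congruent₂ _∧_
    ∨-cong        : Congruent₂ _∨_
    ⇾-cong        : Congruent₂ _⇾_
    ∼-cong        : Congruent₁ ∼_
    sn₁  : ∀ x y → x ∧ (x ∨ y) ≈ x
    sn₂  : ∀ x y z → x ∧ (y ∨ z) ≈ (z ∧ x) ∨ (y ∧ x)
    sn₃  : ∀ x → ∼ (∼ x) ≈ x
    sn₄  : ∀ x y → ∼ (x ∧ y) ≈ (∼ x) ∨ (∼ y)
    sn₅  : ∀ x y → x ∧ (∼ x) ≈ (x ∧ (∼ x)) ∧ (y ∨ (∼ y))
    sn₆  : ∀ x y → x ∧ (x ⇾ᴺ y) ≈ x ∧ ((∼ x) ∨ y)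
    sn₇  : ∀ x y z → (x ⇾ᴺ (y ⇾ᴺ z)) ≈ ((x ∧ y) ⇾ᴺ z)
    sn₈  : ∀ x y z → ((x ⇾ᴺ y) ⇾ᴺ ((y ⇾ᴺ x) ⇾ᴺ ((x ⇾ z) ⇾ᴺ (y ⇾ z)))) ≈ ⊤
    sn₉  : ∀ x y z → ((x ⇾ᴺ y) ⇾ᴺ ((y ⇾ᴺ x) ⇾ᴺ ((z ⇾ x) ⇾ᴺ (z ⇾ y)))) ≈ ⊤
    sn₁₀ : ∀ x y → ((∼ (x ⇾ y)) ⇾ᴺ (x ∧ (∼ y))) ≈ ⊤
    sn₁₁ : ∀ x y → ((x ∧ (∼ y)) ⇾ᴺ (∼ (x ⇾ y))) ≈ ⊤

record SemiNelsonAlgebra c ℓ : Set (suc (c ⊔ ℓ)) where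
  field
    rawSemiNelsonAlgebra : RawSemiNelsonAlgebra c ℓ
    isSemiNelsonAlgebra  : IsSemiNelsonAlgebra rawSemiNelsonAlgebra

  open RawSemiNelsonAlgebra rawSemiNelsonAlgebra public
  open IsSemiNelsonAlgebra isSemiNelsonAlgebra public

module _ {a b ℓ₁ ℓ₂} (A : RawSemiNelsonAlgebra a ℓ₁) (B : RawSemiNelsonAlgebra b ℓ₂) where
  private
    module A = RawSemiNelsonAlgebra A
    module B = RawSemiNelsonAlgebra B
  open MorphismDefinitions A.Carrier B.Carrier B._≈_

  record IsSemiNelsonIsomorphism (⟦_⟧ : A.Carrier → B.Carrier) : Set (a ⊔ b ⊔ ℓ₁ ⊔ ℓ₂) where
    field
      isLatticeIsomorphism : IsLatticeIsomorphism A.rawLattice B.rawLattice ⟦_⟧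
      ⇾-homo               : Homomorphic₂ ⟦_⟧ A._⇾_ B._⇾_
      ∼-homo               : Homomorphic₁ ⟦_⟧ A.∼_ B.∼_
      ⊤-homo               : Homomorphic₀ ⟦_⟧ A.⊤ B.⊤

    open IsLatticeIsomorphism isLatticeIsomorphism public

infix 4 _≅_
_≅_ : ∀ {a b ℓ₁ ℓ₂} → RawSemiNelsonAlgebra a ℓ₁ → RawSemiNelsonAlgebra b ℓ₂ → Set (a ⊔ b ⊔ ℓ₁ ⊔ ℓ₂)
A ≅ B = ∃ (IsSemiNelsonIsomorphism A B)

------------------------------------------------------------------------
-- Filters

module _ {c ℓ} (L : Lattice c ℓ) where
  open Lattice L
  open Poset (LatticeProperties.poset L) using (_≤_)

  record IsLatticeFilter {p} (F : Pred Carrier p) : Set (c ⊔ ℓ ⊔ p) where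
    field
      nonempty : ∃ F
      upward   : ∀ {x y} → x ≤ y → x ∈ F → y ∈ F
      ∧-closed : ∀ {x y} → x ∈ F → y ∈ F → (x ∧ y) ∈ F

module _ {c ℓ} (H : SemiHeytingAlgebra c ℓ) where
  open SemiHeytingAlgebra H

  record IsIFilter {p} (F : Pred Carrier p) : Set (c ⊔ ℓ ⊔ p) where
    field
      isLatticeFilter : IsLatticeFilter lattice F
      dense           : ∀ {x} → Dense x → x ∈ F
      if₃             : ∀ {z t} → (z ∨ t) ∈ F → ∀ x → ((x ⇒ z) ∨ (x ∧ t)) ∈ F

    open IsLatticeFilter isLatticeFilter public

record IFilter {c ℓ} (H : SemiHeytingAlgebra c ℓ) p : Set (c ⊔ ℓ ⊔ suc p) where
  open SemiHeytingAlgebra H using (Carrier)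
  field
    member    : Pred Carrier p
    isIFilter : IsIFilter H member

  open IsIFilter isIFilter public

------------------------------------------------------------------------
-- The relative pseudocomplement of a semi-Heyting algebra is x ⇒ (x ∧ y),
-- so its underlying lattice is a Heyting algebra.

module SemiHeytingProperties {c ℓ} (H : SemiHeytingAlgebra c ℓ) where
  open SemiHeytingAlgebra H
  open R.Lattice (LatticeProperties.∨-∧-orderTheoreticLattice lattice)
    using (_≤_; x∧y≤y; ∧-greatest; isPartialOrder)
    renaming (isLattice to isOrderTheoreticLattice; refl to ≤-refl; trans to ≤-trans)
  open SetoidReasoning (Lattice.setoid lattice)

  ⊥-minimum : ∀ x → ⊥ ≤ x
  ⊥-minimum x = begin
    ⊥            ≈⟨ ∧-absorbs-∨ ⊥ x ⟨
    ⊥ ∧ (⊥ ∨ x)  ≈⟨ ∧-congˡ (proj₁ ∨-identity x) ⟩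
    ⊥ ∧ x        ∎

  ⊤-maximum : ∀ x → x ≤ ⊤
  ⊤-maximum x = sym (proj₂ ∧-identity x)

  residual-curry : ∀ w x y → w ∧ x ≤ y → w ≤ x ⇒ (x ∧ y)
  residual-curry w x y wx≤y = sym (begin
    w ∧ (x ⇒ (x ∧ y))              ≈⟨ sh₂ w x (x ∧ y) ⟩
    w ∧ ((w ∧ x) ⇒ (w ∧ (x ∧ y)))  ≈⟨ ∧-congˡ (⇒-cong refl (trans (sym (∧-assoc w x y)) (sym wx≤y))) ⟩
    w ∧ ((w ∧ x) ⇒ (w ∧ x))        ≈⟨ ∧-congˡ (sh₃ (w ∧ x)) ⟩
    w ∧ ⊤                          ≈⟨ proj₂ ∧-identity w ⟩
    w                              ∎)

  residual-uncurry : ∀ w x y → w ≤ x ⇒ (x ∧ y) → w ∧ x ≤ y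
  residual-uncurry w x y w≤r = begin
    w ∧ x                      ≈⟨ ∧-congʳ w≤r ⟩
    (w ∧ r) ∧ x                ≈⟨ ∧-assoc w r x ⟩
    w ∧ (r ∧ x)                ≈⟨ ∧-congˡ r∧x≤y ⟩
    w ∧ ((r ∧ x) ∧ y)          ≈⟨ ∧-assoc w (r ∧ x) y ⟨
    (w ∧ (r ∧ x)) ∧ y          ≈⟨ ∧-congʳ (∧-assoc w r x) ⟨
    ((w ∧ r) ∧ x) ∧ y          ≈⟨ ∧-congʳ (∧-congʳ w≤r) ⟨
    (w ∧ x) ∧ y                ∎
    where
    r : Carrier
    r = x ⇒ (x ∧ y)
    r∧x≈x∧y : r ∧ x ≈ x ∧ y
    r∧x≈x∧y = begin
      r ∧ x        ≈⟨ ∧-comm r x ⟩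
      x ∧ r        ≈⟨ sh₁ x (x ∧ y) ⟩
      x ∧ (x ∧ y)  ≈⟨ ∧-assoc x x y ⟨
      (x ∧ x) ∧ y  ≈⟨ ∧-congʳ (LatticeProperties.∧-idem lattice x) ⟩
      x ∧ y        ∎
    r∧x≤y : r ∧ x ≤ y
    r∧x≤y = ≤-trans (Poset.≤-respˡ-≈ (LatticeProperties.poset lattice) (sym r∧x≈x∧y) ≤-refl) (x∧y≤y x y)

  heytingAlgebra : R.HeytingAlgebra c ℓ ℓ
  heytingAlgebra = record
    { _⇨_ = λ x y → x ⇒ (x ∧ y)
    ; isHeytingAlgebra = record
      { isBoundedLattice = record
        { isLattice = isOrderTheoreticLattice
        ; maximum   = ⊤-maximum
        ; minimum   = ⊥-minimum
        }
      ; exponential = λ w x y → residual-curry w x y , residual-uncurry w x y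
      }
    }

  open HeytingProperties heytingAlgebra public using (∧-distribˡ-∨)

  ∧-distribʳ-∨ : ∀ x y z → (y ∨ z) ∧ x ≈ (y ∧ x) ∨ (z ∧ x)
  ∧-distribʳ-∨ x y z = begin
    (y ∨ z) ∧ x        ≈⟨ ∧-comm (y ∨ z) x ⟩
    x ∧ (y ∨ z)        ≈⟨ ∧-distribˡ-∨ x y z ⟩
    (x ∧ y) ∨ (x ∧ z)  ≈⟨ ∨-cong (∧-comm x y) (∧-comm x z) ⟩
    (y ∧ x) ∨ (z ∧ x)  ∎

------------------------------------------------------------------------
-- The algebra N(H,F)

module _ {c ℓ p} (H : SemiHeytingAlgebra c ℓ) (F : IFilter H p) where
  open SemiHeytingAlgebra H
  open IFilter F
  open SemiHeytingProperties H
  open SetoidReasoning (Lattice.setoid lattice)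
  open R.HeytingAlgebra heytingAlgebra
    using (_≤_; x≤x∨y; y≤x∨y; ∨-least; x∧y≤x; x∧y≤y)
    renaming (trans to ≤-trans; reflexive to ≤-reflexive; antisym to ≤-antisym)

  record Pair : Set (c ⊔ ℓ ⊔ p) where
    constructor pair
    field
      fst      : Carrier
      snd      : Carrier
      disjoint : fst ∧ snd ≈ ⊥
      cover    : (fst ∨ snd) ∈ member

  private
    ≤⊥⇒≈⊥ : ∀ {x} → x ≤ ⊥ → x ≈ ⊥
    ≤⊥⇒≈⊥ x≤⊥ = ≤-antisym x≤⊥ (⊥-minimum _)

    ≈-member : ∀ {x y} → x ≈ y → x ∈ member → y ∈ member
    ≈-member x≈y = upward (≤-reflexive x≈y)

    ∧∨-disjoint : ∀ {a b c d} → a ∧ b ≈ ⊥ → c ∧ d ≈ ⊥ → (a ∧ c) ∧ (b ∨ d) ≈ ⊥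
    ∧∨-disjoint {a} {b} {c} {d} ab≈⊥ cd≈⊥ = begin
      (a ∧ c) ∧ (b ∨ d)              ≈⟨ ∧-distribˡ-∨ (a ∧ c) b d ⟩
      ((a ∧ c) ∧ b) ∨ ((a ∧ c) ∧ d)  ≈⟨ ∨-cong left right ⟩
      ⊥ ∨ ⊥                          ≈⟨ proj₁ ∨-identity ⊥ ⟩
      ⊥                              ∎
      where
      left : (a ∧ c) ∧ b ≈ ⊥
      left = ≤⊥⇒≈⊥ (≤-trans (≤-reflexive (trans (∧-congʳ (∧-comm a c)) (∧-assoc c a b)))
                   (≤-trans (x∧y≤y c (a ∧ b)) (≤-reflexive ab≈⊥)))
      right : (a ∧ c) ∧ d ≈ ⊥
      right = ≤⊥⇒≈⊥ (≤-trans (≤-reflexive (∧-assoc a c d))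
                    (≤-trans (x∧y≤y a (c ∧ d)) (≤-reflexive cd≈⊥)))

    ∧∨-cover : ∀ {a b c d} → (a ∨ b) ∈ member → (c ∨ d) ∈ member →
               ((a ∧ c) ∨ (b ∨ d)) ∈ member
    ∧∨-cover {a} {b} {c} {d} ab∈F cd∈F = upward below (∧-closed ab∈F cd∈F)
      where
      target : Carrier
      target = (a ∧ c) ∨ (b ∨ d)
      b≤ : b ≤ target
      b≤ = ≤-trans (x≤x∨y b d) (y≤x∨y (a ∧ c) (b ∨ d))
      d≤ : d ≤ target
      d≤ = ≤-trans (y≤x∨y b d) (y≤x∨y (a ∧ c) (b ∨ d))
      below : (a ∨ b) ∧ (c ∨ d) ≤ target
      below = ≤-trans (≤-reflexive (∧-distribʳ-∨ (c ∨ d) a b)) (∨-least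
        (≤-trans (≤-reflexive (∧-distribˡ-∨ a c d)) (∨-least
          (x≤x∨y (a ∧ c) (b ∨ d))
          (≤-trans (x∧y≤y a d) d≤)))
        (≤-trans (x∧y≤x b (c ∨ d)) b≤))

    ⇒∧-disjoint : ∀ a c d → c ∧ d ≈ ⊥ → (a ⇒ c) ∧ (a ∧ d) ≈ ⊥
    ⇒∧-disjoint a c d cd≈⊥ = ≤⊥⇒≈⊥ (≤-trans (≤-reflexive (begin
      (a ⇒ c) ∧ (a ∧ d)  ≈⟨ ∧-assoc (a ⇒ c) a d ⟨
      ((a ⇒ c) ∧ a) ∧ d  ≈⟨ ∧-congʳ (trans (∧-comm (a ⇒ c) a) (sh₁ a c)) ⟩
      (a ∧ c) ∧ d        ≈⟨ ∧-assoc a c d ⟩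
      a ∧ (c ∧ d)        ∎)) (≤-trans (x∧y≤y a (c ∧ d)) (≤-reflexive cd≈⊥)))

    ⊤∨⊥∈F : (⊤ ∨ ⊥) ∈ member
    ⊤∨⊥∈F = let x , x∈F = nonempty in
      upward (≤-trans (⊤-maximum x) (x≤x∨y ⊤ ⊥)) x∈F

  -- The equality of pairs ignores the proof components.
  N : RawSemiNelsonAlgebra (c ⊔ ℓ ⊔ p) ℓ
  N = record
    { Carrier = Pair
    ; _≈_     = λ (pair a b _ _) (pair c d _ _) → (a ≈ c) × (b ≈ d)
    ; _∧_     = λ (pair a b ab≈⊥ ab∈F) (pair c d cd≈⊥ cd∈F) →
        pair (a ∧ c) (b ∨ d) (∧∨-disjoint ab≈⊥ cd≈⊥) (∧∨-cover ab∈F cd∈F)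
    ; _∨_     = λ (pair a b ab≈⊥ ab∈F) (pair c d cd≈⊥ cd∈F) →
        pair (a ∨ c) (b ∧ d)
          (trans (∧-comm _ _) (∧∨-disjoint (trans (∧-comm b a) ab≈⊥) (trans (∧-comm d c) cd≈⊥)))
          (≈-member (∨-comm _ _) (∧∨-cover (≈-member (∨-comm a b) ab∈F) (≈-member (∨-comm c d) cd∈F)))
    ; _⇾_     = λ (pair a b _ _) (pair c d cd≈⊥ cd∈F) →
        pair (a ⇒ c) (a ∧ d) (⇒∧-disjoint a c d cd≈⊥) (if₃ cd∈F a)
    ; ∼_      = λ (pair a b ab≈⊥ ab∈F) →
        pair b a (trans (∧-comm b a) ab≈⊥) (≈-member (∨-comm a b) ab∈F)
    ; ⊤       = pair ⊤ ⊥ (proj₁ ∧-identity ⊥) ⊤∨⊥∈F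
    }

-- H is A itself under the coarser equality x ≋ y given by x ≼ y and y ≼ x, where
-- x ≼ y means x ⇾ᴺ y ≈ ⊤, equivalently x ≤ ∼ x ∨ y.  F is the up-set generated by
-- the elements a ∨ ∼ a, and the isomorphism is x ↦ (x , ∼ x): it is injective because
-- x ≼ y and ∼ y ≼ ∼ x together give x ≤ y by Kleene's law.
module Submission where

open import Defs
open import Algebra.Core using (Op₂)
open import Algebra.Definitions using (Congruent₂)
open import Data.Product.Base using (Σ-syntax; ∃; _×_; _,_; proj₁; proj₂)
open import Level using (_⊔_)
open import Relation.Binary.Bundles using (Setoid)
open import Relation.Binary.Core using (Rel)
import Relation.Binary.Lattice as R
import Relation.Binary.Lattice.Properties.DistributiveLattice as DistributiveLatticeProperties
import Relation.Binary.Lattice.Properties.JoinSemilattice as JoinSemilatticeProperties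
import Relation.Binary.Lattice.Properties.Lattice as LatticeProperties
import Relation.Binary.Lattice.Properties.MeetSemilattice as MeetSemilatticeProperties
import Relation.Binary.Reasoning.PartialOrder as PartialOrderReasoning
import Relation.Binary.Reasoning.Setoid as SetoidReasoning
open import Relation.Binary.Structures using (IsEquivalence)

-- Sholander's two-identity axiomatisation of distributive lattices.
module Sholander {a ℓ} {A : Set a} (_≈_ : Rel A ℓ) (_∧_ _∨_ : Op₂ A)
  (isEquivalence : IsEquivalence _≈_)
  (∧-cong : Congruent₂ _≈_ _∧_) (∨-cong : Congruent₂ _≈_ _∨_)
  (absorb : ∀ x y → (x ∧ (x ∨ y)) ≈ x)
  (distrib : ∀ x y z → (x ∧ (y ∨ z)) ≈ ((z ∧ x) ∨ (y ∧ x)))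
  where

  open IsEquivalence isEquivalence

  setoid : Setoid a ℓ
  setoid = record { isEquivalence = isEquivalence }

  open SetoidReasoning setoid

  expand : ∀ x y → x ≈ ((y ∧ x) ∨ (x ∧ x))
  expand x y = trans (sym (absorb x y)) (distrib x x y)

  -- By `expand x x`, `x` is the join of `x ∧ x` with itself, so absorption collapses `(x ∧ x) ∧ x`
  -- to `x ∧ x`. Distributing over the expanded second factor then gives that same join back.
  ∧-idem : ∀ x → (x ∧ x) ≈ x
  ∧-idem x = begin
    x ∧ x                          ≈⟨ ∧-cong refl (expand x x) ⟩
    x ∧ ((x ∧ x) ∨ (x ∧ x))        ≈⟨ distrib x (x ∧ x) (x ∧ x) ⟩
    ((x ∧ x) ∧ x) ∨ ((x ∧ x) ∧ x)  ≈⟨ ∨-cong xx∧x≈xx xx∧x≈xx ⟩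
    (x ∧ x) ∨ (x ∧ x)              ≈⟨ expand x x ⟨
    x                              ∎
    where
    xx∧x≈xx : ((x ∧ x) ∧ x) ≈ (x ∧ x)
    xx∧x≈xx = trans (∧-cong refl (expand x x)) (absorb (x ∧ x) (x ∧ x))

  y∧x∨x≈x : ∀ x y → ((y ∧ x) ∨ x) ≈ x
  y∧x∨x≈x x y = trans (∨-cong refl (sym (∧-idem x))) (sym (expand x y))

  ∨-idem : ∀ x → (x ∨ x) ≈ x
  ∨-idem x = trans (∨-cong (sym (∧-idem x)) refl) (y∧x∨x≈x x x)

  ∧-comm : ∀ x y → (x ∧ y) ≈ (y ∧ x)
  ∧-comm x y = begin
    x ∧ y              ≈⟨ ∧-cong refl (∨-idem y) ⟨
    x ∧ (y ∨ y)        ≈⟨ distrib x y y ⟩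
    (y ∧ x) ∨ (y ∧ x)  ≈⟨ ∨-idem (y ∧ x) ⟩
    y ∧ x              ∎

  -- Since `distrib` reverses the order of the joinands, squaring `x ∨ u` and distributing swaps it
  -- to `u ∨ x`, where `y∧x∨x≈x` applies.
  x∨y∧x≈x : ∀ x y → (x ∨ (y ∧ x)) ≈ x
  x∨y∧x≈x x y = begin
    x ∨ u                          ≈⟨ ∧-idem (x ∨ u) ⟨
    (x ∨ u) ∧ (x ∨ u)              ≈⟨ distrib (x ∨ u) x u ⟩
    (u ∧ (x ∨ u)) ∨ (x ∧ (x ∨ u))  ≈⟨ ∨-cong u∧[x∨u]≈u (absorb x u) ⟩
    u ∨ x                          ≈⟨ y∧x∨x≈x x y ⟩
    x                              ∎
    where
    u : A
    u = y ∧ x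
    x∧u≈u : (x ∧ u) ≈ u
    x∧u≈u = begin
      x ∧ u        ≈⟨ ∧-comm x u ⟩
      u ∧ x        ≈⟨ ∧-cong refl (y∧x∨x≈x x y) ⟨
      u ∧ (u ∨ x)  ≈⟨ absorb u x ⟩
      u            ∎
    u∧[x∨u]≈u : (u ∧ (x ∨ u)) ≈ u
    u∧[x∨u]≈u = begin
      u ∧ (x ∨ u)        ≈⟨ distrib u x u ⟩
      (u ∧ u) ∨ (x ∧ u)  ≈⟨ ∨-cong (∧-idem u) x∧u≈u ⟩
      u ∨ u              ≈⟨ ∨-idem u ⟩
      u                  ∎

  -- The same squaring trick, now for arbitrary joinands.
  ∨-comm : ∀ x y → (x ∨ y) ≈ (y ∨ x)
  ∨-comm x y = begin
    x ∨ y                          ≈⟨ ∧-idem (x ∨ y) ⟨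
    (x ∨ y) ∧ (x ∨ y)              ≈⟨ distrib (x ∨ y) x y ⟩
    (y ∧ (x ∨ y)) ∨ (x ∧ (x ∨ y))  ≈⟨ ∨-cong y∧[x∨y]≈y (absorb x y) ⟩
    y ∨ x                          ∎
    where
    y∧[x∨y]≈y : (y ∧ (x ∨ y)) ≈ y
    y∧[x∨y]≈y = begin
      y ∧ (x ∨ y)        ≈⟨ distrib y x y ⟩
      (y ∧ y) ∨ (x ∧ y)  ≈⟨ ∨-cong (∧-idem y) refl ⟩
      y ∨ (x ∧ y)        ≈⟨ x∨y∧x≈x y x ⟩
      y                  ∎

  ∧-distribˡ-∨ : ∀ x y z → (x ∧ (y ∨ z)) ≈ ((x ∧ y) ∨ (x ∧ z))
  ∧-distribˡ-∨ x y z = begin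
    x ∧ (y ∨ z)        ≈⟨ distrib x y z ⟩
    (z ∧ x) ∨ (y ∧ x)  ≈⟨ ∨-cong (∧-comm z x) (∧-comm y x) ⟩
    (x ∧ z) ∨ (x ∧ y)  ≈⟨ ∨-comm (x ∧ z) (x ∧ y) ⟩
    (x ∧ y) ∨ (x ∧ z)  ∎

  _≤_ : Rel A ℓ
  x ≤ y = x ≈ (x ∧ y)

  x≤y⇒x∨y≈y : ∀ {x y} → x ≤ y → (x ∨ y) ≈ y
  x≤y⇒x∨y≈y {x} {y} x≤y = trans (∨-cong x≤y refl) (y∧x∨x≈x y x)

  x∨y≈y⇒x≤y : ∀ {x y} → (x ∨ y) ≈ y → x ≤ y
  x∨y≈y⇒x≤y {x} {y} x∨y≈y = trans (sym (absorb x y)) (∧-cong refl x∨y≈y)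

  -- Avoids associativity: absorption and distributivity turn `x` into `x ∧ (y ∨ z)`, and `y ∨ z` is
  -- `z`.
  ≤-trans : ∀ {x y z} → x ≤ y → y ≤ z → x ≤ z
  ≤-trans {x} {y} {z} x≤y y≤z = begin
    x                  ≈⟨ x∨y∧x≈x x z ⟨
    x ∨ (z ∧ x)        ≈⟨ ∨-cong x≤y (∧-comm z x) ⟩
    (x ∧ y) ∨ (x ∧ z)  ≈⟨ ∧-distribˡ-∨ x y z ⟨
    x ∧ (y ∨ z)        ≈⟨ ∧-cong refl (x≤y⇒x∨y≈y y≤z) ⟩
    x ∧ z              ∎

  x∧y≤y : ∀ x y → (x ∧ y) ≤ y
  x∧y≤y x y = x∨y≈y⇒x≤y (y∧x∨x≈x y x)

  ∨-least : ∀ {x y z} → x ≤ z → y ≤ z → (x ∨ y) ≤ z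
  ∨-least {x} {y} {z} x≤z y≤z = begin
    x ∨ y              ≈⟨ ∨-cong x≤z y≤z ⟩
    (x ∧ z) ∨ (y ∧ z)  ≈⟨ ∨-cong (∧-comm x z) (∧-comm y z) ⟩
    (z ∧ x) ∨ (z ∧ y)  ≈⟨ ∧-distribˡ-∨ z x y ⟨
    z ∧ (x ∨ y)        ≈⟨ ∧-comm z (x ∨ y) ⟩
    (x ∨ y) ∧ z        ∎

  ∧-greatest : ∀ {x y z} → z ≤ x → z ≤ y → z ≤ (x ∧ y)
  ∧-greatest {x} {y} {z} z≤x z≤y = x∨y≈y⇒x≤y (begin
    z ∨ (x ∧ y)        ≈⟨ ∨-cong (trans z≤y (∧-comm z y)) (∧-comm x y) ⟩
    (y ∧ z) ∨ (y ∧ x)  ≈⟨ ∧-distribˡ-∨ y z x ⟨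
    y ∧ (z ∨ x)        ≈⟨ ∧-cong refl (x≤y⇒x∨y≈y z≤x) ⟩
    y ∧ x              ≈⟨ ∧-comm y x ⟩
    x ∧ y              ∎)

  distributiveLattice : R.DistributiveLattice a ℓ ℓ
  distributiveLattice = record
    { isDistributiveLattice = record
      { isLattice = record
        { isPartialOrder = record
          { isPreorder = record
            { isEquivalence = isEquivalence
            ; reflexive     = λ {x} x≈y → trans (sym (∧-idem x)) (∧-cong refl x≈y)
            ; trans         = ≤-trans
            }
          ; antisym = λ {x} {y} x≤y y≤x → trans x≤y (trans (∧-comm x y) (sym y≤x))
          }
        ; supremum = λ x y →
            sym (absorb x y) ,
            trans (sym (absorb y x)) (∧-cong refl (∨-comm y x)) ,
            λ _ → ∨-least
        ; infimum  = λ x y →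
            x∨y≈y⇒x≤y (trans (∨-cong (∧-comm x y) refl) (y∧x∨x≈x x y)) ,
            x∧y≤y x y ,
            λ _ → ∧-greatest
        }
      ; ∧-distribˡ-∨ = ∧-distribˡ-∨
      }
    }

module SemiNelsonProperties {c ℓ} (A : SemiNelsonAlgebra c ℓ) where

  open SemiNelsonAlgebra A

  distributiveLattice : R.DistributiveLattice c ℓ ℓ
  distributiveLattice =
    Sholander.distributiveLattice _≈_ _∧_ _∨_ isEquivalence ∧-cong ∨-cong sn₁ sn₂

  open R.DistributiveLattice distributiveLattice
    using (_≤_; poset; joinSemilattice; meetSemilattice; ∧-distribˡ-∨;
           x≤x∨y; y≤x∨y; ∨-least; x∧y≤x; x∧y≤y; ∧-greatest)
    renaming (refl to ≤-refl; reflexive to ≤-reflexive; trans to ≤-trans; antisym to ≤-antisym)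
  open DistributiveLatticeProperties distributiveLattice using (∨-distribˡ-∧)
  open JoinSemilatticeProperties joinSemilattice using (∨-comm; ∨-monotonic)
  open MeetSemilatticeProperties meetSemilattice using (∧-comm; ∧-idempotent; ∧-monotonic)
  open IsEquivalence isEquivalence
  open PartialOrderReasoning poset

  -- De Morgan and Kleene laws.

  ∼-∨ : ∀ x y → ∼ (x ∨ y) ≈ ∼ x ∧ ∼ y
  ∼-∨ x y = begin-equality
    ∼ (x ∨ y)              ≈⟨ ∼-cong (∨-cong (sn₃ x) (sn₃ y)) ⟨
    ∼ (∼ (∼ x) ∨ ∼ (∼ y))  ≈⟨ ∼-cong (sn₄ (∼ x) (∼ y)) ⟨
    ∼ (∼ (∼ x ∧ ∼ y))      ≈⟨ sn₃ (∼ x ∧ ∼ y) ⟩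
    ∼ x ∧ ∼ y              ∎

  ∼-antitone : ∀ {x y} → x ≤ y → ∼ y ≤ ∼ x
  ∼-antitone {x} {y} x≤y = begin
    ∼ y        ≤⟨ y≤x∨y (∼ x) (∼ y) ⟩
    ∼ x ∨ ∼ y  ≈⟨ sn₄ x y ⟨
    ∼ (x ∧ y)  ≈⟨ ∼-cong x≤y ⟨
    ∼ x        ∎

  kleene : ∀ x y → x ∧ ∼ x ≤ y ∨ ∼ y
  -- `x ≤ y` unfolds to `x ≈ x ∧ y`, so the axiom already has this form.
  kleene = sn₅

  -- The implication `⇾ᴺ` and the relation `≼`.

  ⇾ᴺ-cong : ∀ {x y u v} → x ≈ y → u ≈ v → (x ⇾ᴺ u) ≈ (y ⇾ᴺ v)
  ⇾ᴺ-cong x≈y u≈v = ⇾-cong x≈y (∧-cong x≈y u≈v)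

  ⇾ᴺ≈⇾ : ∀ {x y} → y ≤ x → (x ⇾ᴺ y) ≈ (x ⇾ y)
  ⇾ᴺ≈⇾ {x} {y} y≤x = ⇾-cong refl (trans (∧-comm x y) (sym y≤x))

  infix 4 _≼_
  _≼_ : Rel Carrier ℓ
  x ≼ y = (x ⇾ᴺ y) ≈ ⊤

  ⇾ᴺ-uncurry : ∀ x y z w → (x ⇾ᴺ (y ⇾ᴺ (z ⇾ᴺ w))) ≈ ((x ∧ (y ∧ z)) ⇾ᴺ w)
  ⇾ᴺ-uncurry x y z w = trans (⇾ᴺ-cong refl (sn₇ y z w)) (sn₇ x (y ∧ z) w)

  -- Uncurrying `sn₈` shows it as a local congruence law: the first two meetands say that `x` and
  -- `y` agree.
  ⇾-congʳ-≼ : ∀ x y z → (x ⇾ᴺ y) ∧ ((y ⇾ᴺ x) ∧ (x ⇾ z)) ≼ (y ⇾ z)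
  ⇾-congʳ-≼ x y z = trans (sym (⇾ᴺ-uncurry _ _ _ _)) (sn₈ x y z)

  ⇾-congˡ-≼ : ∀ x y z → (x ⇾ᴺ y) ∧ ((y ⇾ᴺ x) ∧ (z ⇾ x)) ≼ (z ⇾ y)
  ⇾-congˡ-≼ x y z = trans (sym (⇾ᴺ-uncurry _ _ _ _)) (sn₉ x y z)

  -- Top and bottom elements.

  x≤x⇾x : ∀ x → x ≤ (x ⇾ x)
  x≤x⇾x x = begin-equality
    x                  ≈⟨ y≤x∨y (∼ x) x ⟩
    x ∧ (∼ x ∨ x)      ≈⟨ sn₆ x x ⟨
    x ∧ (x ⇾ᴺ x)       ≈⟨ ∧-cong refl (⇾ᴺ≈⇾ ≤-refl) ⟩
    x ∧ (x ⇾ x)        ∎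

  -- With all variables of `sn₈` equal to `x`, the premise is a meet of copies of `t` and the
  -- conclusion is `t`. This ties `⊤` to the order: two uses of `x≤x⇾x` climb from `x` to this
  -- element.
  [x⇾x]⇾[x⇾x]≈⊤ : ∀ x → ((x ⇾ x) ⇾ (x ⇾ x)) ≈ ⊤
  [x⇾x]⇾[x⇾x]≈⊤ x = begin-equality
    (t ⇾ t)                                  ≈⟨ ⇾ᴺ≈⇾ ≤-refl ⟨
    (t ⇾ᴺ t)                                 ≈⟨ ⇾ᴺ-cong ttt≈t refl ⟨
    (((x ⇾ᴺ x) ∧ ((x ⇾ᴺ x) ∧ t)) ⇾ᴺ t)       ≈⟨ ⇾-congʳ-≼ x x x ⟩
    ⊤                                        ∎
    where
    t : Carrier
    t = x ⇾ x
    ttt≈t : (x ⇾ᴺ x) ∧ ((x ⇾ᴺ x) ∧ t) ≈ t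
    ttt≈t = begin-equality
      (x ⇾ᴺ x) ∧ ((x ⇾ᴺ x) ∧ t)  ≈⟨ ∧-cong (⇾ᴺ≈⇾ ≤-refl) (∧-cong (⇾ᴺ≈⇾ ≤-refl) refl) ⟩
      t ∧ (t ∧ t)                ≈⟨ ∧-cong refl (∧-idempotent t) ⟩
      t ∧ t                      ≈⟨ ∧-idempotent t ⟩
      t                          ∎

  ⊤-maximum : ∀ x → x ≤ ⊤
  ⊤-maximum x = begin
    x                    ≤⟨ x≤x⇾x x ⟩
    x ⇾ x                ≤⟨ x≤x⇾x (x ⇾ x) ⟩
    (x ⇾ x) ⇾ (x ⇾ x)    ≈⟨ [x⇾x]⇾[x⇾x]≈⊤ x ⟩
    ⊤                    ∎

  ⊥ : Carrier
  ⊥ = ∼ ⊤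

  ⊥-minimum : ∀ x → ⊥ ≤ x
  ⊥-minimum x = ≤-trans (∼-antitone (⊤-maximum (∼ x))) (≤-reflexive (sn₃ x))

  ⊤∧x≈x : ∀ x → ⊤ ∧ x ≈ x
  ⊤∧x≈x x = trans (∧-comm ⊤ x) (sym (⊤-maximum x))

  ⊥∨x≈x : ∀ x → ⊥ ∨ x ≈ x
  ⊥∨x≈x x = ≤-antisym (∨-least (⊥-minimum x) ≤-refl) (y≤x∨y ⊥ x)

  ⊤⇾ᴺx≈x : ∀ x → (⊤ ⇾ᴺ x) ≈ x
  ⊤⇾ᴺx≈x x = begin-equality
    (⊤ ⇾ᴺ x)       ≈⟨ ⊤∧x≈x (⊤ ⇾ᴺ x) ⟨
    ⊤ ∧ (⊤ ⇾ᴺ x)   ≈⟨ sn₆ ⊤ x ⟩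
    ⊤ ∧ (⊥ ∨ x)    ≈⟨ ⊤∧x≈x (⊥ ∨ x) ⟩
    ⊥ ∨ x          ≈⟨ ⊥∨x≈x x ⟩
    x              ∎

  ⊤⇾x≈x : ∀ x → (⊤ ⇾ x) ≈ x
  ⊤⇾x≈x x = trans (sym (⇾ᴺ≈⇾ (⊤-maximum x))) (⊤⇾ᴺx≈x x)

  x⇾ᴺ⊤≈x⇾x : ∀ x → (x ⇾ᴺ ⊤) ≈ (x ⇾ x)
  x⇾ᴺ⊤≈x⇾x x = ⇾-cong refl (sym (⊤-maximum x))

  -- In `sn₈` with `⊤` in the second place, the premise collapses to `x` and the conclusion `⊤ ⇾ x`
  -- is `x`.
  x⇾x≈⊤ : ∀ x → (x ⇾ x) ≈ ⊤
  x⇾x≈⊤ x = begin-equality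
    (x ⇾ x)                                       ≈⟨ ⇾ᴺ≈⇾ ≤-refl ⟨
    (x ⇾ᴺ x)                                      ≈⟨ ⇾ᴺ-cong premise≈x (⊤⇾x≈x x) ⟨
    (((x ⇾ᴺ ⊤) ∧ ((⊤ ⇾ᴺ x) ∧ (x ⇾ x))) ⇾ᴺ (⊤ ⇾ x))  ≈⟨ ⇾-congʳ-≼ x ⊤ x ⟩
    ⊤                                             ∎
    where
    premise≈x : (x ⇾ᴺ ⊤) ∧ ((⊤ ⇾ᴺ x) ∧ (x ⇾ x)) ≈ x
    premise≈x = begin-equality
      (x ⇾ᴺ ⊤) ∧ ((⊤ ⇾ᴺ x) ∧ (x ⇾ x))  ≈⟨ ∧-cong (x⇾ᴺ⊤≈x⇾x x) (∧-cong (⊤⇾ᴺx≈x x) refl) ⟩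
      (x ⇾ x) ∧ (x ∧ (x ⇾ x))          ≈⟨ ∧-cong refl (x≤x⇾x x) ⟨
      (x ⇾ x) ∧ x                      ≈⟨ ∧-comm (x ⇾ x) x ⟩
      x ∧ (x ⇾ x)                      ≈⟨ x≤x⇾x x ⟨
      x                                ∎

  -- The relation `≼` in terms of the order, and its bounds.

  ≼⇒≤ : ∀ {x y} → x ≼ y → x ≤ ∼ x ∨ y
  ≼⇒≤ {x} {y} x≼y = begin-equality
    x                ≈⟨ ⊤-maximum x ⟩
    x ∧ ⊤            ≈⟨ ∧-cong refl x≼y ⟨
    x ∧ (x ⇾ᴺ y)     ≈⟨ sn₆ x y ⟩
    x ∧ (∼ x ∨ y)    ∎

  -- Duplicating the premise, `sn₇` exposes `x ∧ (x ⇾ᴺ y)`, which is `x` by `sn₆` and the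
  -- hypothesis.
  ≤⇒≼ : ∀ {x y} → x ≤ ∼ x ∨ y → x ≼ y
  ≤⇒≼ {x} {y} x≤∼x∨y = begin-equality
    (x ⇾ᴺ y)               ≈⟨ ⇾ᴺ-cong (∧-idempotent x) refl ⟨
    ((x ∧ x) ⇾ᴺ y)         ≈⟨ sn₇ x x y ⟨
    (x ⇾ (x ∧ (x ⇾ᴺ y)))   ≈⟨ ⇾-cong refl (trans (sn₆ x y) (sym x≤∼x∨y)) ⟩
    (x ⇾ x)                ≈⟨ x⇾x≈⊤ x ⟩
    ⊤                      ∎

  ≤-⊆-≼ : ∀ {x y} → x ≤ y → x ≼ y
  ≤-⊆-≼ x≤y = ≤⇒≼ (≤-trans x≤y (y≤x∨y _ _))

  ≼-≤-trans : ∀ {x y z} → x ≼ y → y ≤ z → x ≼ z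
  ≼-≤-trans x≼y y≤z = ≤⇒≼ (≤-trans (≼⇒≤ x≼y) (∨-monotonic ≤-refl y≤z))

  ≼-curry : ∀ {x y z} → x ∧ y ≼ z → x ≼ (y ⇾ᴺ z)
  ≼-curry = trans (sn₇ _ _ _)

  ≤-≼-trans : ∀ {x y z} → x ≤ y → y ≼ z → x ≼ z
  ≤-≼-trans {x} {y} {z} x≤y y≼z = begin-equality
    (x ⇾ᴺ z)           ≈⟨ ⇾ᴺ-cong x≤y refl ⟩
    ((x ∧ y) ⇾ᴺ z)     ≈⟨ sn₇ x y z ⟨
    (x ⇾ᴺ (y ⇾ᴺ z))    ≈⟨ ⇾ᴺ-cong refl y≼z ⟩
    (x ⇾ᴺ ⊤)           ≈⟨ ≤-⊆-≼ (⊤-maximum x) ⟩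
    ⊤                  ∎

  ⊤≼x⇒x≈⊤ : ∀ {x} → ⊤ ≼ x → x ≈ ⊤
  ⊤≼x⇒x≈⊤ = trans (sym (⊤⇾ᴺx≈x _))

  -- With y′ = x ∧ y and u = y′ ∧ z, the elements x and y′ are ≼-equivalent, so
  -- sn₈ turns y′ ⇾ u ≈ ⊤ into x ⇾ u ≈ ⊤.
  ≼-trans : ∀ {x y z} → x ≼ y → y ≼ z → x ≼ z
  ≼-trans {x} {y} {z} x≼y y≼z = ≼-≤-trans x≼u (x∧y≤y y′ z)
    where
    y′ u : Carrier
    y′ = x ∧ y
    u  = y′ ∧ z
    x≼y′ : x ≼ y′
    x≼y′ = trans (⇾-cong refl (≤-antisym (x∧y≤y _ _) (∧-greatest (x∧y≤x _ _) ≤-refl))) x≼y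
    y′⇾u≈⊤ : (y′ ⇾ u) ≈ ⊤
    y′⇾u≈⊤ = ≤-≼-trans (x∧y≤y x y) y≼z
    ⊤≤premise : ⊤ ≤ (y′ ⇾ᴺ x) ∧ ((x ⇾ᴺ y′) ∧ (y′ ⇾ u))
    ⊤≤premise = ∧-greatest (≤-reflexive (sym (≤-⊆-≼ (x∧y≤x x y))))
                           (∧-greatest (≤-reflexive (sym x≼y′)) (≤-reflexive (sym y′⇾u≈⊤)))
    x≼u : x ≼ u
    x≼u = trans (⇾ᴺ≈⇾ (≤-trans (x∧y≤x y′ z) (x∧y≤x x y)))
                (⊤≼x⇒x≈⊤ (≤-≼-trans ⊤≤premise (⇾-congʳ-≼ y′ x u)))

  ≼-∧-greatest : ∀ {x y z} → z ≼ x → z ≼ y → z ≼ x ∧ y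
  ≼-∧-greatest z≼x z≼y = ≤⇒≼ (≤-trans (∧-greatest (≼⇒≤ z≼x) (≼⇒≤ z≼y))
                                      (≤-reflexive (sym (∨-distribˡ-∧ _ _ _))))

  -- Kleene's law bounds the part `x ∧ ∼ x` by `y ∨ ∼ y` for an arbitrary `y`; the rest of `x` is
  -- below `z`.
  x≤y∨∼y∨z : ∀ {x y z} → x ≼ z → x ≤ (y ∨ ∼ y) ∨ z
  x≤y∨∼y∨z {x} {y} {z} x≼z = begin
    x                        ≤⟨ ∧-greatest ≤-refl (≼⇒≤ x≼z) ⟩
    x ∧ (∼ x ∨ z)            ≈⟨ ∧-distribˡ-∨ x (∼ x) z ⟩
    (x ∧ ∼ x) ∨ (x ∧ z)      ≤⟨ ∨-monotonic (kleene x y) (x∧y≤y x z) ⟩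
    (y ∨ ∼ y) ∨ z            ∎

  x≤∼y∨z : ∀ {x y z} → x ≼ z → y ≼ z → x ≤ ∼ y ∨ z
  x≤∼y∨z {x} {y} {z} x≼z y≼z = begin
    x                ≤⟨ x≤y∨∼y∨z x≼z ⟩
    (y ∨ ∼ y) ∨ z    ≤⟨ ∨-least (∨-least (≼⇒≤ y≼z) (x≤x∨y (∼ y) z)) (y≤x∨y (∼ y) z) ⟩
    ∼ y ∨ z          ∎

  -- `∼ (x ∨ y) ∨ z` is the meet of `∼ x ∨ z` and `∼ y ∨ z`, so each of `x` and `y` must lie below
  -- both; `x≤∼y∨z` supplies the crossed inequalities.
  ≼-∨-least : ∀ {x y z} → x ≼ z → y ≼ z → x ∨ y ≼ z
  ≼-∨-least {x} {y} {z} x≼z y≼z = ≤⇒≼ (begin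
    x ∨ y                      ≤⟨ ∨-least (∧-greatest (≼⇒≤ x≼z) (x≤∼y∨z x≼z y≼z))
                                          (∧-greatest (x≤∼y∨z y≼z x≼z) (≼⇒≤ y≼z)) ⟩
    (∼ x ∨ z) ∧ (∼ y ∨ z)      ≈⟨ ∧-cong (∨-comm _ _) (∨-comm _ _) ⟩
    (z ∨ ∼ x) ∧ (z ∨ ∼ y)      ≈⟨ ∨-distribˡ-∧ z (∼ x) (∼ y) ⟨
    z ∨ (∼ x ∧ ∼ y)            ≈⟨ ∨-comm _ _ ⟩
    (∼ x ∧ ∼ y) ∨ z            ≈⟨ ∨-cong (∼-∨ x y) refl ⟨
    ∼ (x ∨ y) ∨ z              ∎)

  ≼-∼-≼⇒≤ : ∀ {x y} → x ≼ y → ∼ y ≼ ∼ x → x ≤ y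
  ≼-∼-≼⇒≤ {x} {y} x≼y ∼y≼∼x = begin
    x                                ≤⟨ ∧-greatest ≤-refl (≼⇒≤ x≼y) ⟩
    x ∧ (∼ x ∨ y)                    ≈⟨ ∧-distribˡ-∨ x (∼ x) y ⟩
    (x ∧ ∼ x) ∨ (x ∧ y)              ≤⟨ ∨-least x∧∼x≤y (x∧y≤y x y) ⟩
    y                                ∎
    where
    -- The second hypothesis amounts to `∼ y ≤ ∼ x ∨ y`; negating both sides gives this.
    x∧∼y≤y : x ∧ ∼ y ≤ y
    x∧∼y≤y = begin
      x ∧ ∼ y              ≈⟨ ∧-cong (sn₃ x) refl ⟨
      ∼ (∼ x) ∧ ∼ y        ≈⟨ ∼-∨ (∼ x) y ⟨
      ∼ (∼ x ∨ y)          ≤⟨ ∼-antitone (≤-trans (≼⇒≤ ∼y≼∼x)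
                                (∨-least (≤-trans (≤-reflexive (sn₃ y)) (y≤x∨y (∼ x) y)) (x≤x∨y (∼ x) y))) ⟩
      ∼ (∼ y)              ≈⟨ sn₃ y ⟩
      y                    ∎
    -- Kleene's law splits `x ∧ ∼ x` along `y ∨ ∼ y`, and both pieces fall below `y`.
    x∧∼x≤y : x ∧ ∼ x ≤ y
    x∧∼x≤y = begin
      x ∧ ∼ x                ≤⟨ ∧-greatest (x∧y≤x x (∼ x)) (kleene x y) ⟩
      x ∧ (y ∨ ∼ y)          ≈⟨ ∧-distribˡ-∨ x y (∼ y) ⟩
      (x ∧ y) ∨ (x ∧ ∼ y)    ≤⟨ ∨-least (x∧y≤y x y) x∧∼y≤y ⟩
      y                      ∎

  -- Preparation for the filter and for the implication of `H`.

  ∼[x∨∼x]≈x∧∼x : ∀ x → ∼ (x ∨ ∼ x) ≈ x ∧ ∼ x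
  ∼[x∨∼x]≈x∧∼x x = begin-equality
    ∼ (x ∨ ∼ x)      ≈⟨ ∼-∨ x (∼ x) ⟩
    ∼ x ∧ ∼ (∼ x)    ≈⟨ ∧-cong refl (sn₃ x) ⟩
    ∼ x ∧ x          ≈⟨ ∧-comm (∼ x) x ⟩
    x ∧ ∼ x          ∎

  x∧∼x≼⊥ : ∀ x → x ∧ ∼ x ≼ ⊥
  x∧∼x≼⊥ x = ≤⇒≼ (begin
    x ∧ ∼ x              ≤⟨ x∧y≤y x (∼ x) ⟩
    ∼ x                  ≤⟨ x≤x∨y (∼ x) (∼ (∼ x)) ⟩
    ∼ x ∨ ∼ (∼ x)        ≈⟨ sn₄ x (∼ x) ⟨
    ∼ (x ∧ ∼ x)          ≤⟨ x≤x∨y _ ⊥ ⟩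
    ∼ (x ∧ ∼ x) ∨ ⊥      ∎)

  -- The negation of the meet joins `x ∧ ∼ x` and `y ∧ ∼ y`, each below both factors by Kleene's
  -- law. Hence the meet of two generators of `F` is its own witness of membership.
  ∧-∨∼-closed : ∀ x y → let z = (x ∨ ∼ x) ∧ (y ∨ ∼ y) in z ∨ ∼ z ≤ z
  ∧-∨∼-closed x y = ∨-least ≤-refl (begin
    ∼ ((x ∨ ∼ x) ∧ (y ∨ ∼ y))        ≈⟨ sn₄ _ _ ⟩
    ∼ (x ∨ ∼ x) ∨ ∼ (y ∨ ∼ y)        ≈⟨ ∨-cong (∼[x∨∼x]≈x∧∼x x) (∼[x∨∼x]≈x∧∼x y) ⟩
    (x ∧ ∼ x) ∨ (y ∧ ∼ y)            ≤⟨ ∨-least (∧-greatest (kleene x x) (kleene x y))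
                                                (∧-greatest (kleene y x) (kleene y y)) ⟩
    (x ∨ ∼ x) ∧ (y ∨ ∼ y)            ∎)

  -- Currying turns agreement below `w` into the premises of `sn₈`, which replaces the antecedent,
  -- and then of `sn₉`, which replaces the consequent. Taking `w` to be `⊤` gives congruence of `⇾`;
  -- taking it to be `x` gives the first two semi-Heyting identities.
  ⇾-local : ∀ {w x x′ y y′} → w ∧ x ≼ x′ → w ∧ x′ ≼ x → w ∧ y ≼ y′ → w ∧ y′ ≼ y →
            w ∧ (x ⇾ y) ≼ w ∧ (x′ ⇾ y′)
  ⇾-local {w} {x} {x′} {y} {y′} wx≼x′ wx′≼x wy≼y′ wy′≼y =
    ≼-∧-greatest w∧[x⇾y]≼w (≼-trans (≼-∧-greatest w∧[x⇾y]≼w w∧[x⇾y]≼x′⇾y) w∧[x′⇾y]≼x′⇾y′)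
    where
    w∧[x⇾y]≼w : w ∧ (x ⇾ y) ≼ w
    w∧[x⇾y]≼w = ≤-⊆-≼ (x∧y≤x _ _)
    w∧[x⇾y]≼x′⇾y : w ∧ (x ⇾ y) ≼ (x′ ⇾ y)
    w∧[x⇾y]≼x′⇾y = ≼-trans
      (≼-∧-greatest (≤-≼-trans (x∧y≤x _ _) (≼-curry wx≼x′))
        (≼-∧-greatest (≤-≼-trans (x∧y≤x _ _) (≼-curry wx′≼x)) (≤-⊆-≼ (x∧y≤y _ _))))
      (⇾-congʳ-≼ x x′ y)
    w∧[x′⇾y]≼x′⇾y′ : w ∧ (x′ ⇾ y) ≼ (x′ ⇾ y′)
    w∧[x′⇾y]≼x′⇾y′ = ≼-trans
      (≼-∧-greatest (≤-≼-trans (x∧y≤x _ _) (≼-curry wy≼y′))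
        (≼-∧-greatest (≤-≼-trans (x∧y≤x _ _) (≼-curry wy′≼y)) (≤-⊆-≼ (x∧y≤y _ _))))
      (⇾-congˡ-≼ y y′ x′)

  -- The quotient semi-Heyting algebra `H`.

  infix 4 _≋_
  _≋_ : Rel Carrier ℓ
  x ≋ y = x ≼ y × y ≼ x

  ≈⇒≋ : ∀ {x y} → x ≈ y → x ≋ y
  ≈⇒≋ x≈y = ≤-⊆-≼ (≤-reflexive x≈y) , ≤-⊆-≼ (≤-reflexive (sym x≈y))

  -- Presented by its order, so that the lattice equations up to `≋` follow from the bounds already
  -- proved for `≼`.
  ≼-lattice : R.Lattice c ℓ ℓ
  ≼-lattice = record
    { Carrier   = Carrier
    ; _≈_       = _≋_
    ; _≤_       = _≼_
    ; _∨_       = _∨_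
    ; _∧_       = _∧_
    ; isLattice = record
      { isPartialOrder = record
        { isPreorder = record
          { isEquivalence = record
            { refl  = ≈⇒≋ refl
            ; sym   = λ (x≼y , y≼x) → y≼x , x≼y
            ; trans = λ (x≼y , y≼x) (y≼z , z≼y) → ≼-trans x≼y y≼z , ≼-trans z≼y y≼x
            }
          ; reflexive = proj₁
          ; trans     = ≼-trans
          }
        ; antisym = _,_
        }
      ; supremum = λ x y → ≤-⊆-≼ (x≤x∨y x y) , ≤-⊆-≼ (y≤x∨y x y) , λ _ → ≼-∨-least
      ; infimum  = λ x y → ≤-⊆-≼ (x∧y≤x x y) , ≤-⊆-≼ (x∧y≤y x y) , λ _ → ≼-∧-greatest
      }
    }

  open R.Lattice ≼-lattice
    using ()
    renaming (x∧y≤x to x∧y≼x; x∧y≤y to x∧y≼y; refl to ≼-refl;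
              joinSemilattice to ≼-joinSemilattice; meetSemilattice to ≼-meetSemilattice)
  open JoinSemilatticeProperties ≼-joinSemilattice
    using () renaming (∨-monotonic to ≼-∨-monotonic)
  open MeetSemilatticeProperties ≼-meetSemilattice
    using () renaming (∧-monotonic to ≼-∧-monotonic)

  ⇾-cong-≼ : ∀ {x x′ y y′} → x ≋ x′ → y ≋ y′ → (x ⇾ y) ≼ (x′ ⇾ y′)
  ⇾-cong-≼ {x} {x′} {y} {y′} (x≼x′ , x′≼x) (y≼y′ , y′≼y) =
    ≤-≼-trans (≤-reflexive (sym (⊤∧x≈x (x ⇾ y)))) (≼-≤-trans
      (⇾-local (⊤∧-≼ x≼x′) (⊤∧-≼ x′≼x) (⊤∧-≼ y≼y′) (⊤∧-≼ y′≼y))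
      (x∧y≤y ⊤ (x′ ⇾ y′)))
    where
    ⊤∧-≼ : ∀ {u v} → u ≼ v → ⊤ ∧ u ≼ v
    ⊤∧-≼ = ≤-≼-trans (x∧y≤y _ _)

  -- Below `x` the antecedent `x` agrees with `⊤`, and `⊤ ⇾ y` is `y`.
  x∧[x⇾y]≋x∧y : ∀ x y → x ∧ (x ⇾ y) ≋ x ∧ y
  x∧[x⇾y]≋x∧y x y =
    ≼-≤-trans (⇾-local x∧x≼⊤ (x∧y≼x x ⊤) (x∧y≼y x y) (x∧y≼y x y)) (≤-reflexive x∧[⊤⇾y]≈x∧y) ,
    ≤-≼-trans (≤-reflexive (sym x∧[⊤⇾y]≈x∧y)) (⇾-local (x∧y≼x x ⊤) x∧x≼⊤ (x∧y≼y x y) (x∧y≼y x y))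
    where
    x∧x≼⊤ : x ∧ x ≼ ⊤
    x∧x≼⊤ = ≤-⊆-≼ (⊤-maximum _)
    x∧[⊤⇾y]≈x∧y : x ∧ (⊤ ⇾ y) ≈ x ∧ y
    x∧[⊤⇾y]≈x∧y = ∧-cong refl (⊤⇾x≈x y)

  -- Below `x`, any `u` agrees with `x ∧ u`.
  x∧[y⇾z]≋x∧[x∧y⇾x∧z] : ∀ x y z → x ∧ (y ⇾ z) ≋ x ∧ (x ∧ y ⇾ x ∧ z)
  x∧[y⇾z]≋x∧[x∧y⇾x∧z] x y z =
    ⇾-local ≼-refl (drop y) ≼-refl (drop z) , ⇾-local (drop y) ≼-refl (drop z) ≼-refl
    where
    drop : ∀ u → x ∧ (x ∧ u) ≼ u
    drop u = ≤-⊆-≼ (≤-trans (x∧y≤y _ _) (x∧y≤y _ _))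

  semiHeytingAlgebra : SemiHeytingAlgebra c ℓ
  semiHeytingAlgebra = record
    { Carrier = Carrier
    ; _≈_     = _≋_
    ; _∧_     = _∧_
    ; _∨_     = _∨_
    ; _⇒_     = _⇾_
    ; ⊥       = ⊥
    ; ⊤       = ⊤
    ; isSemiHeytingAlgebra = record
      { isLattice  = LatticeProperties.isAlgLattice ≼-lattice
      ; ∨-identity = (λ x → ≈⇒≋ (⊥∨x≈x x)) , (λ x → ≈⇒≋ (trans (∨-comm x ⊥) (⊥∨x≈x x)))
      ; ∧-identity = (λ x → ≈⇒≋ (⊤∧x≈x x)) , (λ x → ≈⇒≋ (sym (⊤-maximum x)))
      ; ⇒-cong     = λ { x≋x′@(x≼x′ , x′≼x) y≋y′@(y≼y′ , y′≼y) →
                         ⇾-cong-≼ x≋x′ y≋y′ , ⇾-cong-≼ (x′≼x , x≼x′) (y′≼y , y≼y′) }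
      ; sh₁        = x∧[x⇾y]≋x∧y
      ; sh₂        = x∧[y⇾z]≋x∧[x∧y⇾x∧z]
      ; sh₃        = λ x → ≈⇒≋ (x⇾x≈⊤ x)
      }
    }

  -- Pseudocomplements in `H`.

  ⊥≼x : ∀ {x} → ⊥ ≼ x
  ⊥≼x = ≤-⊆-≼ (⊥-minimum _)

  x∧[x⇾⊥]≼⊥ : ∀ x → x ∧ (x ⇾ ⊥) ≼ ⊥
  x∧[x⇾⊥]≼⊥ x = ≼-≤-trans (proj₁ (x∧[x⇾y]≋x∧y x ⊥)) (x∧y≤y x ⊥)

  -- Currying yields `x ⇾ᴺ ⊥`, which is `x ⇾ ⊥` because `⊥` is below `x`.
  disjoint⇒≼⇾⊥ : ∀ {x y} → x ∧ y ≼ ⊥ → y ≼ (x ⇾ ⊥)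
  disjoint⇒≼⇾⊥ {x} {y} x∧y≼⊥ =
    ≼-≤-trans (≼-curry (≤-≼-trans (≤-reflexive (∧-comm y x)) x∧y≼⊥))
              (≤-reflexive (⇾ᴺ≈⇾ (⊥-minimum x)))

  ∼[x⇾y]≋x∧∼y : ∀ x y → ∼ (x ⇾ y) ≋ x ∧ ∼ y
  ∼[x⇾y]≋x∧∼y x y = sn₁₀ x y , sn₁₁ x y

  -- Provides a representative of the class of `x` whose negation is the pseudocomplement, the
  -- largest that a negation can be there. It holds because `∼ ⊥` is `⊤`.
  ∼[x⇾⊥]≋x : ∀ x → ∼ (x ⇾ ⊥) ≋ x
  ∼[x⇾⊥]≋x x = ≼-≤-trans (proj₁ (∼[x⇾y]≋x∧∼y x ⊥)) (x∧y≤x x (∼ ⊥)) ,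
               ≤-≼-trans x≤x∧∼⊥ (proj₂ (∼[x⇾y]≋x∧∼y x ⊥))
    where
    x≤x∧∼⊥ : x ≤ x ∧ ∼ ⊥
    x≤x∧∼⊥ = ∧-greatest ≤-refl (≤-trans (⊤-maximum x) (≤-reflexive (sym (sn₃ ⊤))))

  -- The filter `F`, and elements realising a given pair.

  InFilter : Carrier → Set (c ⊔ ℓ)
  InFilter x = ∃ λ a → a ∨ ∼ a ≼ x

  InFilter-∧ : ∀ {x y} → InFilter x → InFilter y → InFilter (x ∧ y)
  InFilter-∧ (a , a∨∼a≼x) (b , b∨∼b≼y) =
    (a ∨ ∼ a) ∧ (b ∨ ∼ b) , ≤-≼-trans (∧-∨∼-closed a b) (≼-∧-monotonic a∨∼a≼x b∨∼b≼y)

  -- Viewed in N(H,F), ∼ (x ⇾ ⊥) is (x , x*), y ⇾ ⊥ is (y* , y), and a ∨ ∼ a is some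
  -- (f , 0) with f ≤ x ∨ y; as y* ∧ f ≤ x and y ≤ x*, the witness z is (x , y).
  disjoint-cover⇒∃ : ∀ {x y} → x ∧ y ≼ ⊥ → InFilter (x ∨ y) → ∃ λ z → z ≋ x × ∼ z ≋ y
  disjoint-cover⇒∃ {x} {y} x∧y≼⊥ (a , d≼x∨y) =
    z , (≼-∨-least (proj₁ (∼[x⇾⊥]≋x x)) y*∧d≼x , ≼-≤-trans (proj₂ (∼[x⇾⊥]≋x x)) (x≤x∨y _ _)) ,
    (≤-≼-trans (≤-reflexive ∼z≈) (≼-trans (x∧y≼y _ _) (≼-∨-least (proj₁ (∼[x⇾⊥]≋x y)) ∼d≼y)) ,
     ≼-≤-trans (≼-∧-greatest (disjoint⇒≼⇾⊥ x∧y≼⊥) (≼-≤-trans (proj₂ (∼[x⇾⊥]≋x y)) (x≤x∨y _ _)))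
               (≤-reflexive (sym ∼z≈)))
    where
    d z : Carrier
    d = a ∨ ∼ a
    z = ∼ (x ⇾ ⊥) ∨ ((y ⇾ ⊥) ∧ d)
    ∼z≈ : ∼ z ≈ (x ⇾ ⊥) ∧ (∼ (y ⇾ ⊥) ∨ ∼ d)
    ∼z≈ = trans (∼-∨ _ _) (∧-cong (sn₃ _) (sn₄ _ _))
    ∼d≼y : ∼ d ≼ y
    ∼d≼y = ≤-≼-trans (≤-reflexive (∼[x∨∼x]≈x∧∼x a)) (≼-trans (x∧∼x≼⊥ a) ⊥≼x)
    y*∧d≼x : (y ⇾ ⊥) ∧ d ≼ x
    y*∧d≼x = ≼-trans (≼-∧-monotonic ≼-refl d≼x∨y)
      (≤-≼-trans (≤-reflexive (∧-distribˡ-∨ (y ⇾ ⊥) x y))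
        (≼-∨-least (x∧y≼y _ _)
          (≤-≼-trans (≤-reflexive (∧-comm _ _)) (≼-trans (x∧[x⇾⊥]≼⊥ y) ⊥≼x))))

  -- z and t need not be disjoint, but replacing t by t ∧ z* makes them so, and
  -- z ∨ (t ∧ z*) remains in the filter since z ∨ z* is in it.
  InFilter-⇾ : ∀ {z t} → InFilter (z ∨ t) → ∀ x → InFilter ((x ⇾ z) ∨ (x ∧ t))
  InFilter-⇾ {z} {t} z∨t∈F x =
    let e , e≋z , ∼e≼t′ , _ = disjoint-cover⇒∃ z∧t′≼⊥ z∨t′∈F in
    x ⇾ e , ≼-∨-monotonic (⇾-cong-≼ (≈⇒≋ refl) e≋z)
              (≼-trans (proj₁ (∼[x⇾y]≋x∧∼y x e))
                       (≼-∧-monotonic ≼-refl (≼-≤-trans ∼e≼t′ (x∧y≤x t (z ⇾ ⊥)))))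
    where
    t′ : Carrier
    t′ = t ∧ (z ⇾ ⊥)
    z∧t′≼⊥ : z ∧ t′ ≼ ⊥
    z∧t′≼⊥ = ≤-≼-trans (∧-monotonic ≤-refl (x∧y≤y t (z ⇾ ⊥))) (x∧[x⇾⊥]≼⊥ z)
    z∨z*∈F : InFilter (z ∨ (z ⇾ ⊥))
    z∨z*∈F = z , ≼-∨-monotonic ≼-refl (disjoint⇒≼⇾⊥ (x∧∼x≼⊥ z))
    z∨t′∈F : InFilter (z ∨ t′)
    z∨t′∈F = let a , a∨∼a≼ = InFilter-∧ z∨t∈F z∨z*∈F in
      a , ≼-≤-trans a∨∼a≼ (≤-reflexive (sym (∨-distribˡ-∧ z t (z ⇾ ⊥))))

  iFilter : IFilter semiHeytingAlgebra (c ⊔ ℓ)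
  iFilter = record
    { member    = InFilter
    ; isIFilter = record
      { isLatticeFilter = record
        { nonempty = ⊤ , ⊤ , ≤-⊆-≼ (⊤-maximum _)
        ; upward   = λ (x≼x∧y , _) (a , a∨∼a≼x) →
                       a , ≼-trans a∨∼a≼x (≼-≤-trans x≼x∧y (x∧y≤y _ _))
        ; ∧-closed = InFilter-∧
        }
      -- The witness is `x` itself: `∼ x` is disjoint from `x` in `H`, hence below its
      -- pseudocomplement, which is `⊥`.
      ; dense = λ {x} (x*≼⊥ , _) →
                  x , ≼-∨-least ≼-refl
                        (≼-trans (disjoint⇒≼⇾⊥ (x∧∼x≼⊥ x)) (≼-trans x*≼⊥ ⊥≼x))
      ; if₃   = InFilter-⇾
      }
    }

  -- The isomorphism onto `N(H,F)`.

  toPair : Carrier → Pair semiHeytingAlgebra iFilter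
  toPair x = pair x (∼ x) (x∧∼x≼⊥ x , ⊥≼x) (x , ≼-refl)

  toPair-isIsomorphism :
    IsSemiNelsonIsomorphism rawSemiNelsonAlgebra (N semiHeytingAlgebra iFilter) toPair
  toPair-isIsomorphism = record
    { isLatticeIsomorphism = record
      { isLatticeMonomorphism = record
        { isLatticeHomomorphism = record
          { isRelHomomorphism = record { cong = λ x≈y → ≈⇒≋ x≈y , ≈⇒≋ (∼-cong x≈y) }
          ; ∧-homo = λ x y → ≈⇒≋ refl , ≈⇒≋ (sn₄ x y)
          ; ∨-homo = λ x y → ≈⇒≋ refl , ≈⇒≋ (∼-∨ x y)
          }
        ; injective = λ ((x≼y , y≼x) , (∼x≼∼y , ∼y≼∼x)) →
            ≤-antisym (≼-∼-≼⇒≤ x≼y ∼y≼∼x) (≼-∼-≼⇒≤ y≼x ∼x≼∼y)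
        }
      ; surjective = λ (pair x y (x∧y≼⊥ , _) x∨y∈F) →
          let z , (z≼x , x≼z) , (∼z≼y , y≼∼z) = disjoint-cover⇒∃ x∧y≼⊥ x∨y∈F in
          z , λ w≈z →
            (≤-≼-trans (≤-reflexive w≈z) z≼x , ≼-≤-trans x≼z (≤-reflexive (sym w≈z))) ,
            (≤-≼-trans (≤-reflexive (∼-cong w≈z)) ∼z≼y ,
             ≼-≤-trans y≼∼z (≤-reflexive (∼-cong (sym w≈z))))
      }
    -- In the second component this is `sn₁₀` and `sn₁₁` together.
    ; ⇾-homo = λ x y → ≈⇒≋ refl , ∼[x⇾y]≋x∧∼y x y
    ; ∼-homo = λ x → ≈⇒≋ refl , ≈⇒≋ (sn₃ x)
    ; ⊤-homo = ≈⇒≋ refl , ≈⇒≋ refl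
    }

theorem3p6 : ∀ {c ℓ} (A : SemiNelsonAlgebra c ℓ) →
    Σ[ H ∈ SemiHeytingAlgebra c ℓ ] Σ[ F ∈ IFilter H (c ⊔ ℓ) ]
    SemiNelsonAlgebra.rawSemiNelsonAlgebra A ≅ N H F
theorem3p6 A = semiHeytingAlgebra , iFilter , toPair , toPair-isIsomorphism
  where open SemiNelsonProperties A
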